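{- Let $H=(V,E)$ be a hypergraph with $n=|V|$, let $e\in E$, and let $1\leq i<j\leq n$. Define $$b_e^{i,j}=\sum_{F\in\mathcal{B}_e^{i,j}}(-1)^{|F|},\qquad \mathcal{B}_e^{i,j}=\{F\subseteq E\mid e\in F,\ k(F)=i,\ k(F\setminus\{e\})=j\}.$$ Then $$b_e^{i,j}=-\sum_{V_1\sqcup\dots\sqcup V_j=V}\ \prod_{k=1}^{j}a_1(H[V_k]),$$ where the sum is over all (unordered) decompositions of $V$ into $j$ non-empty disjoint subsets $V_1,\dots,V_j$ such that $e$ intersects exactly $j-i+1$ of them.
   Context: A hypergraph is a pair $H=(V,E)$ where $V$ is a finite non-empty set (vertices) and $E$ is a set of subsets of $V$ (edges), each of cardinality at least $2$. Two distinct vertices are neighbours if some edge contains both; connectedness of vertices is the equivalence relation generated by being neighbours, and the connected components are given by its equivalence classes. For $F\subseteq E$, $k(F)$ denotes the number of connected components of the spanning subgraph $(V,F)$ (isolated vertices count as components). For non-empty $V'\subseteq V$, $H[V']$ is the hypergraph with vertex set $V'$ and edge set $\{f\in E\mid f\subseteq V'\}$. For any hypergraph $H'=(V',E')$, $a_1(H')=\sum_{F\subseteq E',\,k(F)=1}(-1)^{|F|}$, where $k(F)$ is the number of connected components of $(V',F)$; this is the coefficient of $\lambda$ in the chromatic polynomial of $H'$. -}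

module Defs where

open import Data.Bool.Properties using () renaming (_≟_ to _≟ᵇ_)
open import Data.Fin.Base using (Fin)
import Data.Fin.Properties as Fin
open import Data.Fin.Subset
  using (Subset; inside; outside; _∈_; _⊆_; _∩_; ⋃; ∣_∣; Nonempty; Empty)
open import Data.Fin.Subset.Properties using (_∈?_; _⊆?_; nonempty?)
open import Data.Integer.Base as ℤ using (ℤ)
open import Data.List.Base using (List; []; _∷_; _++_; map; foldr; filter; length)
import Data.List.Membership.DecPropositional as DecMembership
open import Data.List.Relation.Unary.All as All using (All)
import Data.List.Relation.Unary.All.Properties as All
open import Data.List.Relation.Unary.AllPairs using (AllPairs; allPairs?)
open import Data.List.Relation.Unary.Any using (Any; here; there)
open import Data.List.Relation.Unary.Unique.Propositional using (Unique)
import Data.List.Relation.Unary.Unique.Propositional.Properties as Unique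
open import Data.Nat.Base using (ℕ; zero; suc; _≤_)
import Data.Nat.Properties as ℕ
open import Data.Product.Base using (∃; _×_; _,_; uncurry)
open import Data.Sum.Base using (_⊎_; inj₁; inj₂)
open import Data.Vec.Base using ([]; _∷_)
open import Data.Vec.Properties using (≡-dec)
open import Function.Bundles using (_⇔_; mk⇔; Equivalence)
open import Relation.Binary.Construct.Closure.Equivalence as EqClosure using (EqClosure)
open import Relation.Binary.Construct.Closure.ReflexiveTransitive using (ε)
open import Relation.Binary.Definitions using (DecidableEquality)
open import Relation.Binary.PropositionalEquality.Core using (_≡_; _≢_; refl)
open import Relation.Binary.Structures using (IsEquivalence)
open import Relation.Nullary.Decidable using (Dec; yes; no; map′; ¬?; _×-dec_; _⊎-dec_; _→-dec_)
open import Relation.Unary using (Decidable)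

private
  variable
    A : Set
    N : ℕ

∑ : List A → (A → ℤ) → ℤ
∑ xs f = foldr ℤ._+_ ℤ.0ℤ (map f xs)

∏ : List A → (A → ℤ) → ℤ
∏ xs f = foldr ℤ._*_ ℤ.1ℤ (map f xs)

syntax ∑ xs (λ x → t) = ∑[ x ← xs ] t
syntax ∏ xs (λ x → t) = ∏[ x ← xs ] t

-- When xs is duplicate-free, every subset of the set listed by xs occurs
-- exactly once, listed in the order inherited from xs.
sublists : List A → List (List A)
sublists []       = [] ∷ []
sublists (x ∷ xs) = map (x ∷_) (sublists xs) ++ sublists xs

subsets : (N : ℕ) → List (Subset N)
subsets zero    = [] ∷ []
subsets (suc N) = map (inside ∷_) (subsets N) ++ map (outside ∷_) (subsets N)

infix 4 _≟ˢ_

_≟ˢ_ : DecidableEquality (Subset N)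
_≟ˢ_ = ≡-dec _≟ᵇ_

-- The vertex set is an arbitrary subset of an ambient finite set Fin N, so
-- that H and all its H[V′] have the same type.  A set of edges is
-- represented by a duplicate-free list of subsets of Fin N.
record Hypergraph (N : ℕ) : Set where
  constructor ⟨_,_⟩
  field
    V : Subset N
    E : List (Subset N)

open Hypergraph public

record IsHypergraph (H : Hypergraph N) : Set where
  field
    V-nonempty : Nonempty (V H)
    E-unique   : Unique (E H)
    E⊆V        : All (_⊆ V H) (E H)
    2≤∣E∣      : All (λ f → 2 ≤ ∣ f ∣) (E H)

infix 8 _[_]

_[_] : Hypergraph N → Subset N → Hypergraph N
H [ V′ ] = ⟨ V′ , filter (_⊆? V′) (E H) ⟩

induced-isHypergraph : {H : Hypergraph N} → IsHypergraph H → (V′ : Subset N) →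
                       Nonempty V′ → IsHypergraph (H [ V′ ])
induced-isHypergraph {H = H} isH V′ V′≢∅ = record
  { V-nonempty = V′≢∅
  ; E-unique   = Unique.filter⁺ (_⊆? V′) E-unique
  ; E⊆V        = All.all-filter (_⊆? V′) (E H)
  ; 2≤∣E∣      = All.filter⁺ (_⊆? V′) 2≤∣E∣
  }
  where open IsHypergraph isH

Neighbours : List (Subset N) → Fin N → Fin N → Set
Neighbours F v w = v ≢ w × Any (λ f → v ∈ f × w ∈ f) F

Connected : List (Subset N) → Fin N → Fin N → Set
Connected F = EqClosure (Neighbours F)

private

  -- Connectedness after adding the edge f, expressed through
  -- connectedness before: either f is not needed, or both vertices are
  -- connected to a vertex of f.
  Touches : Subset N → List (Subset N) → Fin N → Set
  Touches f F v = ∃ λ a → a ∈ f × Connected F v a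

  Via : Subset N → List (Subset N) → Fin N → Fin N → Set
  Via f F v w = Connected F v w ⊎ (Touches f F v × Touches f F w)

  module _ (f : Subset N) (F : List (Subset N)) where

    open IsEquivalence (EqClosure.isEquivalence (Neighbours F))
      renaming (refl to ~refl; sym to ~sym; trans to ~trans)

    touches-resp : ∀ {v w} → Connected F v w → Touches f F v → Touches f F w
    touches-resp v~w (a , a∈f , v~a) = a , a∈f , ~trans (~sym v~w) v~a

    via-isEquivalence : IsEquivalence (Via f F)
    via-isEquivalence = record
      { refl  = inj₁ ~refl
      ; sym   = λ { (inj₁ p) → inj₁ (~sym p) ; (inj₂ (p , q)) → inj₂ (q , p) }
      ; trans = λ
        { (inj₁ p)       (inj₁ q)       → inj₁ (~trans p q)
        ; (inj₁ p)       (inj₂ (q , r)) → inj₂ (touches-resp (~sym p) q , r)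
        ; (inj₂ (p , q)) (inj₁ r)       → inj₂ (p , touches-resp r q)
        ; (inj₂ (p , _)) (inj₂ (_ , r)) → inj₂ (p , r)
        }
      }

    neighbours⇒via : ∀ {v w} → Neighbours (f ∷ F) v w → Via f F v w
    neighbours⇒via (_   , here (v∈f , w∈f)) = inj₂ ((_ , v∈f , ~refl) , (_ , w∈f , ~refl))
    neighbours⇒via (v≢w , there p)          = inj₁ (EqClosure.return (v≢w , p))

    weaken : ∀ {v w} → Connected F v w → Connected (f ∷ F) v w
    weaken = EqClosure.map λ (v≢w , p) → v≢w , there p

    edge : ∀ {a b} → a ∈ f → b ∈ f → Connected (f ∷ F) a b
    edge {a} {b} a∈f b∈f with a Fin.≟ b
    ... | yes refl = ε
    ... | no  a≢b  = EqClosure.return (a≢b , here (a∈f , b∈f))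

    via⇒connected : ∀ {v w} → Via f F v w → Connected (f ∷ F) v w
    via⇒connected (inj₁ p) = weaken p
    via⇒connected (inj₂ ((a , a∈f , v~a) , (b , b∈f , w~b))) =
      trans (weaken v~a) (trans (edge a∈f b∈f) (sym (weaken w~b)))
      where open IsEquivalence (EqClosure.isEquivalence (Neighbours (f ∷ F)))

  no-neighbours : ∀ {v w : Fin N} → Connected [] v w → v ≡ w
  no-neighbours = EqClosure.fold isEquivalence λ { (_ , ()) }
    where open import Relation.Binary.PropositionalEquality.Properties using (isEquivalence)

connected? : (F : List (Subset N)) (v w : Fin N) → Dec (Connected F v w)
connected? []      v w = map′ (λ { refl → ε }) no-neighbours (v Fin.≟ w)
connected? (f ∷ F) v w =
  map′ (via⇒connected f F) (EqClosure.fold (via-isEquivalence f F) (neighbours⇒via f F))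
    (connected? F v w ⊎-dec (touches? v ×-dec touches? w))
  where
  touches? : Decidable (Touches f F)
  touches? u = Fin.any? λ a → (a ∈? f) ×-dec connected? F u a

-- S is the connectedness class of some vertex of H.  (Since the edges are
-- contained in V H, such a class is too.)
IsComponent : Hypergraph N → Subset N → Set
IsComponent H S = ∃ λ v → v ∈ V H × (∀ w → w ∈ S ⇔ Connected (E H) v w)

isComponent? : (H : Hypergraph N) → Decidable (IsComponent H)
isComponent? H S = Fin.any? λ v → (v ∈? V H) ×-dec
  Fin.all? λ w → map′ (uncurry mk⇔) (λ p → Equivalence.to p , Equivalence.from p)
    (((w ∈? S) →-dec connected? (E H) v w) ×-dec (connected? (E H) v w →-dec (w ∈? S)))

components : Hypergraph N → List (Subset N)
components {N} H = filter (isComponent? H) (subsets N)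

k : Hypergraph N → List (Subset N) → ℕ
k H F = length (components ⟨ V H , F ⟩)

sign : List A → ℤ
sign F = ℤ.-1ℤ ℤ.^ length F

a₁ : Hypergraph N → ℤ
a₁ H = ∑[ F ← filter (λ F → k H F ℕ.≟ 1) (sublists (E H)) ] sign F

infixl 6 _∖_

_∖_ : List (Subset N) → Subset N → List (Subset N)
F ∖ e = filter (λ f → ¬? (f ≟ˢ e)) F

𝓑 : Hypergraph N → Subset N → ℕ → ℕ → List (List (Subset N))
𝓑 H e i j = filter (λ F → (e ∈ˡ? F) ×-dec (k H F ℕ.≟ i) ×-dec (k H (F ∖ e) ℕ.≟ j))
                   (sublists (E H))
  where open DecMembership _≟ˢ_ using () renaming (_∈?_ to _∈ˡ?_)

b : Hypergraph N → Subset N → ℕ → ℕ → ℤ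
b H e i j = ∑[ F ← 𝓑 H e i j ] sign F

record IsDecomposition (V : Subset N) (P : List (Subset N)) : Set where
  constructor isDecomposition
  field
    nonempty : All Nonempty P
    disjoint : AllPairs (λ S T → Empty (S ∩ T)) P
    covers   : ⋃ P ≡ V

isDecomposition? : (V : Subset N) → Decidable (IsDecomposition V)
isDecomposition? V P =
  map′ (λ (n , d , c) → isDecomposition n d c)
       (λ (isDecomposition n d c) → n , d , c)
       (All.all? nonempty? P ×-dec allPairs? (λ S T → ¬? (nonempty? (S ∩ T))) P
         ×-dec (⋃ P ≟ˢ V))

meets : Subset N → List (Subset N) → ℕ
meets e P = length (filter (λ S → nonempty? (e ∩ S)) P)

-- The unordered decompositions V₁ ⊔ … ⊔ Vⱼ = V such that e intersects exactly
-- m of the Vₖ.  Unordered: a decomposition is a set of blocks, i.e. a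
-- sublist of the fixed enumeration of all subsets.
decompositions : Subset N → Subset N → (j m : ℕ) → List (List (Subset N))
decompositions {N} V e j m =
  filter (λ P → isDecomposition? V P ×-dec (length P ℕ.≟ j) ×-dec (meets e P ℕ.≟ m))
         (sublists (subsets N))

{-# OPTIONS --safe #-}
-- For e ∈ F put G = F ∖ e.  Adding e to G merges exactly the components of G
-- that meet e, so k(F) = k(G) + 1 − #{components of G meeting e}; hence b is
-- minus the signed number of G ⊆ E ∖ e with j components, of which j − i + 1
-- meet e.  Now sort these G by their decomposition P into components.  A given
-- P is the one of G iff every edge of G lies within a block of P and the edges
-- within each block connect it, so G is an independent choice of a connected
-- spanning edge set in every block, and the signed count factorises.  Since e
-- meets at least two blocks it lies within none, so each factor is a₁(H[Vₖ]).
module Submission where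

open import Defs
open import Data.Nat.Base using (ℕ; _+_; _∸_; _≤_; _<_)
open import Data.Integer.Base using (-_)
open import Data.Fin.Subset using (Subset; ∣_∣)
open import Data.List.Membership.Propositional using (_∈_)
open import Relation.Binary.PropositionalEquality using (_≡_)

open import Data.Bool.Base using (true; false; if_then_else_)
open import Data.Fin.Base using (Fin)
import Data.Fin.Properties as Fin
open import Data.Fin.Subset using (_⊆_; _∩_; ⋃; Nonempty; Empty; inside; outside)
  renaming (_∈_ to _∈ₛ_)
open import Data.Fin.Subset.Properties
  using (_⊆?_; nonempty?; ⊆-antisym; ∉⊥; ∣⊥∣≡0; Empty-unique; x∈p∩q⁺; x∈p∩q⁻; x∈p∪q⁺; x∈p∪q⁻)
open import Data.Integer.Base as ℤ using (ℤ; 0ℤ) renaming (_+_ to _+ᶻ_; _*_ to _*ᶻ_)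
import Data.Integer.Properties as ℤ
open import Algebra.Properties.CommutativeSemigroup ℤ.+-commutativeSemigroup using (interchange)
open import Algebra.Properties.CommutativeSemigroup ℤ.*-commutativeSemigroup using (x∙yz≈y∙xz)
open import Data.List.Base using (List; []; _∷_; _++_; map; filter; length)
import Data.List.Membership.DecPropositional as DecMembership
open import Data.List.Membership.Propositional using (_∉_; find; lose)
open import Data.List.Membership.Propositional.Properties
  using (∈-++⁺ˡ; ∈-++⁺ʳ; ∈-++⁻; ∈-map⁺; ∈-map⁻; ∈-map∷⁻; ∈-filter⁺; ∈-filter⁻; ∈-AllPairs₂)
open import Data.List.Properties using (filter-all; filter-accept; filter-reject; ∷-injectiveʳ)
open import Data.List.Relation.Unary.All as All using (All; []; _∷_)
import Data.List.Relation.Unary.All.Properties as All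
open import Data.List.Relation.Unary.AllPairs using (AllPairs; []; _∷_)
import Data.List.Relation.Unary.AllPairs.Properties as AllPairs
open import Data.List.Relation.Unary.Any as Any using (Any; here; there)
open import Data.List.Relation.Unary.Unique.Propositional using (Unique)
import Data.List.Relation.Unary.Unique.Propositional.Properties as Unique
open import Data.Nat.Base using (zero; suc; z≤n; s≤s)
import Data.Nat.Properties as ℕ
open import Data.Product.Base using (∃; _×_; _,_; proj₁; proj₂)
open import Data.Sum.Base using (inj₁; inj₂)
open import Data.Vec.Base using (tabulate) renaming ([] to []ᵛ; _∷_ to _∷ᵛ_)
import Data.Vec.Properties as Vec
open import Function.Base using (_∘_; id)
open import Function.Bundles using (_⇔_; mk⇔; Equivalence)
open import Relation.Binary.Construct.Closure.Equivalence as EqClosure using ()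
open import Relation.Binary.Construct.Closure.ReflexiveTransitive using (ε; _◅_; _◅◅_)
open import Relation.Binary.Construct.Closure.Symmetric using (fwd; bwd)
open import Relation.Binary.PropositionalEquality
  using (_≢_; refl; sym; trans; cong; cong₂; subst; module ≡-Reasoning)
open import Relation.Nullary using (¬_; Dec; yes; no; does; contradiction)
open import Relation.Nullary.Decidable using (_×-dec_; ¬?; does-⇔; dec-true; dec-false)
open import Relation.Unary using (Decidable)

open ≡-Reasoning

private
  variable
    A B P Q : Set
    N : ℕ
    xs : List A
    f g : A → ℤ

-- Guarded terms and finite sums

infixl 1 _when_

-- Guarding the terms keeps the index list fixed, where `filter` would let it vary with the
-- condition. Sums can then be interchanged and conditions replaced term by term.
_when_ : ℤ → Dec P → ℤ
x when p = if does p then x else 0ℤ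

when-cong : ∀ {x y} {p : Dec P} {q : Dec Q} → (P → x ≡ y) → P ⇔ Q → (x when p) ≡ (y when q)
when-cong {p = p} {q} x≡y P⇔Q rewrite sym (does-⇔ P⇔Q p q) with p
... | yes P = x≡y P
... | no  _ = refl

when-no : ∀ x (p : Dec P) → ¬ P → (x when p) ≡ 0ℤ
when-no x p ¬P rewrite dec-false p ¬P = refl

when-× : ∀ x (p : Dec P) (q : Dec Q) → ((x when p) when q) ≡ (x when q ×-dec p)
when-× x p q with does q
... | true  = refl
... | false = refl

when-* : ∀ x y (p : Dec P) (q : Dec Q) → (x when p) *ᶻ (y when q) ≡ (x *ᶻ y when p ×-dec q)
when-* x y p q with does p | does q
... | true  | true  = refl
... | true  | false = ℤ.*-zeroʳ x
... | false | true  = ℤ.*-zeroˡ y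
... | false | false = refl

when-neg : ∀ x (p : Dec P) → (- x when p) ≡ - (x when p)
when-neg x p with does p
... | true  = refl
... | false = refl

∑-cong : (∀ {x} → x ∈ xs → f x ≡ g x) → ∑ xs f ≡ ∑ xs g
∑-cong {xs = []}     f≗g = refl
∑-cong {xs = x ∷ xs} f≗g = cong₂ _+ᶻ_ (f≗g (here refl)) (∑-cong (f≗g ∘ there))

∏-cong : (∀ {x} → x ∈ xs → f x ≡ g x) → ∏ xs f ≡ ∏ xs g
∏-cong {xs = []}     f≗g = refl
∏-cong {xs = x ∷ xs} f≗g = cong₂ _*ᶻ_ (f≗g (here refl)) (∏-cong (f≗g ∘ there))

∑-zero : (∀ {x} → x ∈ xs → f x ≡ 0ℤ) → ∑ xs f ≡ 0ℤ
∑-zero {xs = []}     f≗0 = refl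
∑-zero {xs = x ∷ xs} f≗0 = cong₂ _+ᶻ_ (f≗0 (here refl)) (∑-zero (f≗0 ∘ there))

∑-++ : ∀ (xs ys : List A) → ∑ (xs ++ ys) f ≡ ∑ xs f +ᶻ ∑ ys f
∑-++         []       ys = sym (ℤ.+-identityˡ _)
∑-++ {f = f} (x ∷ xs) ys = trans (cong (f x +ᶻ_) (∑-++ xs ys)) (sym (ℤ.+-assoc (f x) _ _))

∑-map : (h : A → B) (xs : List A) → ∑ (map h xs) f ≡ ∑ xs (f ∘ h)
∑-map         h []       = refl
∑-map {f = f} h (x ∷ xs) = cong (f (h x) +ᶻ_) (∑-map h xs)

∑-+ : ∀ (xs : List A) → ∑[ x ← xs ] (f x +ᶻ g x) ≡ ∑ xs f +ᶻ ∑ xs g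
∑-+                 []       = refl
∑-+ {f = f} {g = g} (x ∷ xs) = begin
  f x +ᶻ g x +ᶻ ∑[ x ← xs ] (f x +ᶻ g x) ≡⟨ cong (f x +ᶻ g x +ᶻ_) (∑-+ xs) ⟩
  f x +ᶻ g x +ᶻ (∑ xs f +ᶻ ∑ xs g)       ≡⟨ interchange (f x) (g x) _ _ ⟩
  f x +ᶻ ∑ xs f +ᶻ (g x +ᶻ ∑ xs g)       ∎

∑-*ˡ : ∀ c (xs : List A) → ∑[ x ← xs ] (c *ᶻ f x) ≡ c *ᶻ ∑ xs f
∑-*ˡ         c []       = sym (ℤ.*-zeroʳ c)
∑-*ˡ {f = f} c (x ∷ xs) = trans (cong (c *ᶻ f x +ᶻ_) (∑-*ˡ c xs)) (sym (ℤ.*-distribˡ-+ c (f x) _))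

∑-neg : ∀ (xs : List A) → ∑[ x ← xs ] (- f x) ≡ - ∑ xs f
∑-neg         []       = refl
∑-neg {f = f} (x ∷ xs) = trans (cong (- f x +ᶻ_) (∑-neg xs)) (sym (ℤ.neg-distrib-+ (f x) _))

∑-when : ∀ (xs : List A) (p : Dec P) → (∑[ x ← xs ] (f x when p)) ≡ (∑ xs f when p)
∑-when xs p with does p
... | true  = refl
... | false = ∑-zero {xs = xs} (λ _ → refl)

∑-swap : ∀ (xs : List A) (ys : List B) (h : A → B → ℤ) →
         (∑[ x ← xs ] ∑[ y ← ys ] h x y) ≡ (∑[ y ← ys ] ∑[ x ← xs ] h x y)
∑-swap []       ys h = sym (∑-zero {xs = ys} (λ _ → refl))
∑-swap (x ∷ xs) ys h = trans (cong (∑ ys (h x) +ᶻ_) (∑-swap xs ys h)) (sym (∑-+ ys))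

∑-filter : ∀ {P : A → Set} (P? : Decidable P) xs → ∑ (filter P? xs) f ≡ (∑[ x ← xs ] (f x when P? x))
∑-filter         P? []       = refl
∑-filter {f = f} P? (x ∷ xs) with does (P? x)
... | true  = cong (f x +ᶻ_) (∑-filter P? xs)
... | false = trans (∑-filter P? xs) (sym (ℤ.+-identityˡ _))

-- Any other entry satisfying `P` would equal `y`, against uniqueness. `P y` itself is not assumed,
-- so both sides may be zero. This lets a sum over all candidate decompositions collapse to a single
-- term.
∑-when-unique : ∀ {P : A → Set} (P? : Decidable P) c {xs y} → Unique xs → y ∈ xs →
           (∀ {x} → x ∈ xs → P x → x ≡ y) →
           (∑[ x ← xs ] (c when P? x)) ≡ (c when P? y)
∑-when-unique P? c {y ∷ xs} (y∉xs ∷ _) (here refl) only = begin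
  (c when P? y) +ᶻ (∑[ x ← xs ] (c when P? x)) ≡⟨ cong ((c when P? y) +ᶻ_) (∑-zero λ {x} x∈xs →
    when-no c (P? x) λ Px → All.lookup y∉xs x∈xs (sym (only (there x∈xs) Px))) ⟩
  (c when P? y) +ᶻ 0ℤ                          ≡⟨ ℤ.+-identityʳ _ ⟩
  (c when P? y)                                 ∎
∑-when-unique P? c {x ∷ xs} {y} (x∉xs ∷ uniq) (there y∈xs) only = begin
  (c when P? x) +ᶻ (∑[ z ← xs ] (c when P? z)) ≡⟨ cong (_+ᶻ (∑[ z ← xs ] (c when P? z))) (when-no c (P? x) λ Px →
    All.lookup x∉xs y∈xs (only (here refl) Px)) ⟩
  0ℤ +ᶻ (∑[ z ← xs ] (c when P? z))            ≡⟨ ℤ.+-identityˡ _ ⟩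
  (∑[ z ← xs ] (c when P? z))                   ≡⟨ ∑-when-unique P? c uniq y∈xs (only ∘ there) ⟩
  (c when P? y)                                 ∎

-- Sums over sublists

∑-sublists : ∀ x (xs : List A) →
             ∑ (sublists (x ∷ xs)) f ≡ (∑[ ys ← sublists xs ] f (x ∷ ys)) +ᶻ ∑ (sublists xs) f
∑-sublists x xs = trans (∑-++ (map (x ∷_) (sublists xs)) (sublists xs))
                        (cong (_+ᶻ _) (∑-map (x ∷_) (sublists xs)))

∈-sublists⇒⊆ : ∀ {xs ys : List A} {y} → ys ∈ sublists xs → y ∈ ys → y ∈ xs
∈-sublists⇒⊆ {xs = []}     (here refl) ()
∈-sublists⇒⊆ {xs = x ∷ xs} ys∈ y∈ys with ∈-++⁻ (map (x ∷_) (sublists xs)) ys∈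
... | inj₂ q = there (∈-sublists⇒⊆ q y∈ys)
... | inj₁ q with ∈-map⁻ (x ∷_) q
...   | zs , zs∈ , refl with y∈ys
...     | here refl = here refl
...     | there y∈zs = there (∈-sublists⇒⊆ zs∈ y∈zs)

∈-sublists⇒unique : ∀ {xs ys : List A} → Unique xs → ys ∈ sublists xs → Unique ys
∈-sublists⇒unique {xs = []}     uniq (here refl) = []
∈-sublists⇒unique {xs = x ∷ xs} (x∉xs ∷ uniq) ys∈ with ∈-++⁻ (map (x ∷_) (sublists xs)) ys∈
... | inj₂ q = ∈-sublists⇒unique uniq q
... | inj₁ q with ∈-map⁻ (x ∷_) q
...   | zs , zs∈ , refl = All.tabulate (λ y∈zs → All.lookup x∉xs (∈-sublists⇒⊆ zs∈ y∈zs))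
                          ∷ ∈-sublists⇒unique uniq zs∈

sublists-unique : ∀ {xs : List A} → Unique xs → Unique (sublists xs)
sublists-unique {xs = []}     []            = [] ∷ []
sublists-unique {xs = x ∷ xs} (x∉xs ∷ uniq) =
  Unique.++⁺ (Unique.map⁺ ∷-injectiveʳ (sublists-unique uniq)) (sublists-unique uniq)
    λ (p , q) → All.lookup x∉xs (∈-sublists⇒⊆ q (∈-map∷⁻ p)) refl

filter∈sublists : ∀ {P : A → Set} (P? : Decidable P) xs → filter P? xs ∈ sublists xs
filter∈sublists P? []       = here refl
filter∈sublists P? (x ∷ xs) with does (P? x)
... | true  = ∈-++⁺ˡ (∈-map⁺ (x ∷_) (filter∈sublists P? xs))
... | false = ∈-++⁺ʳ _ (filter∈sublists P? xs)

-- A sublist inherits the order of `xs`, so its members determine it. Equality of sets thus becomes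
-- equality of lists.
∈-sublists⇒≡filter : ∀ {P : A → Set} (P? : Decidable P) {xs ys} → Unique xs → ys ∈ sublists xs →
                     (∀ {x} → x ∈ xs → x ∈ ys ⇔ P x) → ys ≡ filter P? xs
∈-sublists⇒≡filter P? {[]}     uniq (here refl) _ = refl
∈-sublists⇒≡filter P? {x ∷ xs} (x∉xs ∷ uniq) ys∈ ys⇔P with ∈-++⁻ (map (x ∷_) (sublists xs)) ys∈
... | inj₂ q = trans
  (∈-sublists⇒≡filter P? uniq q (ys⇔P ∘ there))
  (sym (filter-reject P? λ Px →
    All.lookup x∉xs (∈-sublists⇒⊆ q (Equivalence.from (ys⇔P (here refl)) Px)) refl))
... | inj₁ q with ∈-map⁻ (x ∷_) q
...   | zs , zs∈ , refl = trans
  (cong (x ∷_) (∈-sublists⇒≡filter P? uniq zs∈ zs⇔P))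
  (sym (filter-accept P? (Equivalence.to (ys⇔P (here refl)) (here refl))))
  where
  zs⇔P : ∀ {y} → y ∈ xs → y ∈ zs ⇔ _
  zs⇔P y∈xs = mk⇔ (Equivalence.to (ys⇔P (there y∈xs)) ∘ there) λ Py →
    Any.tail (λ { refl → All.lookup x∉xs y∈xs refl }) (Equivalence.from (ys⇔P (there y∈xs)) Py)

-- A subset of L is a pair of a subset of the part of L satisfying P and a
-- subset of the rest.
∑-sublists-filter : ∀ {P : A → Set} (P? : Decidable P) (f g : List A → ℤ) L →
  (∑[ G ← sublists L ] (f (filter P? G) *ᶻ g (filter (¬? ∘ P?) G))) ≡
  ∑ (sublists (filter P? L)) f *ᶻ ∑ (sublists (filter (¬? ∘ P?) L)) g
∑-sublists-filter P? f g [] = trans (ℤ.+-identityʳ (f [] *ᶻ g []))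
  (sym (cong₂ _*ᶻ_ (ℤ.+-identityʳ (f [])) (ℤ.+-identityʳ (g []))))
∑-sublists-filter {A = A} P? f g (x ∷ L) = trans (∑-sublists x L) split
  where
  S⁺ = sublists (filter P? L)
  S⁻ = sublists (filter (¬? ∘ P?) L)
  h : List A → ℤ
  h G = f (filter P? G) *ᶻ g (filter (¬? ∘ P?) G)
  split : (∑[ G ← sublists L ] h (x ∷ G)) +ᶻ ∑ (sublists L) h ≡
          ∑ (sublists (filter P? (x ∷ L))) f *ᶻ ∑ (sublists (filter (¬? ∘ P?) (x ∷ L))) g
  split with does (P? x)
  ... | true = begin
    _ ≡⟨ cong₂ _+ᶻ_ (∑-sublists-filter P? (f ∘ (x ∷_)) g L) (∑-sublists-filter P? f g L) ⟩
    ∑ S⁺ (f ∘ (x ∷_)) *ᶻ ∑ S⁻ g +ᶻ ∑ S⁺ f *ᶻ ∑ S⁻ g ≡⟨ ℤ.*-distribʳ-+ (∑ S⁻ g) (∑ S⁺ (f ∘ (x ∷_))) (∑ S⁺ f) ⟨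
    (∑ S⁺ (f ∘ (x ∷_)) +ᶻ ∑ S⁺ f) *ᶻ ∑ S⁻ g          ≡⟨ cong (_*ᶻ ∑ S⁻ g) (∑-sublists x (filter P? L)) ⟨
    _ ∎
  ... | false = begin
    _ ≡⟨ cong₂ _+ᶻ_ (∑-sublists-filter P? f (g ∘ (x ∷_)) L) (∑-sublists-filter P? f g L) ⟩
    ∑ S⁺ f *ᶻ ∑ S⁻ (g ∘ (x ∷_)) +ᶻ ∑ S⁺ f *ᶻ ∑ S⁻ g ≡⟨ ℤ.*-distribˡ-+ (∑ S⁺ f) _ _ ⟨
    ∑ S⁺ f *ᶻ (∑ S⁻ (g ∘ (x ∷_)) +ᶻ ∑ S⁻ g)          ≡⟨ cong (∑ S⁺ f *ᶻ_) (∑-sublists x (filter (¬? ∘ P?) L)) ⟨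
    _ ∎

sign-filter : ∀ {P : A → Set} (P? : Decidable P) G →
              sign (filter P? G) *ᶻ sign (filter (¬? ∘ P?) G) ≡ sign G
sign-filter P? []      = refl
sign-filter P? (x ∷ G) with does (P? x)
... | true  = trans (ℤ.*-assoc ℤ.-1ℤ (sign (filter P? G)) _) (cong (ℤ.-1ℤ *ᶻ_) (sign-filter P? G))
... | false = trans (x∙yz≈y∙xz (sign (filter P? G)) ℤ.-1ℤ _) (cong (ℤ.-1ℤ *ᶻ_) (sign-filter P? G))

-- Deleting a fixed edge from edge sets

open module SubsetMembership {N} = DecMembership (_≟ˢ_ {N}) using () renaming (_∈?_ to _∈ˡ?_)

∖-∉ : ∀ {F} {e : Subset N} → e ∉ F → F ∖ e ≡ F
∖-∉ {e = e} e∉F = filter-all (λ f → ¬? (f ≟ˢ e)) (All.tabulate λ { f∈F refl → e∉F f∈F })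

-- Since `L` has no duplicates, `F ↦ F ∖ e` is a bijection from the sublists containing `e` to the
-- sublists of `L ∖ e`. The induction runs until `e` is the head; there the sublists of the tail all
-- miss `e` and contribute zero.
∑-sublists-∋ : ∀ {L} {e : Subset N} (f : List (Subset N) → ℤ) → Unique L → e ∈ L →
               (∑[ F ← sublists L ] (f (F ∖ e) when e ∈ˡ? F)) ≡ ∑ (sublists (L ∖ e)) f
∑-sublists-∋ {L = x ∷ L} {e} f (x∉L ∷ uniq) e∈ = trans (∑-sublists x L) (split e∈)
  where
  h : List (Subset _) → ℤ
  h F = f (F ∖ e) when e ∈ˡ? F
  split : e ∈ x ∷ L → (∑[ F ← sublists L ] h (x ∷ F)) +ᶻ ∑ (sublists L) h ≡ ∑ (sublists ((x ∷ L) ∖ e)) f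
  split (here refl) = begin
    (∑[ F ← sublists L ] h (e ∷ F)) +ᶻ ∑ (sublists L) h
      ≡⟨ cong₂ _+ᶻ_ (∑-cong with-e) (∑-zero λ {F} F∈ → when-no (f (F ∖ e)) (e ∈ˡ? F) (e∉ F∈)) ⟩
    ∑ (sublists L) f +ᶻ 0ℤ        ≡⟨ ℤ.+-identityʳ _ ⟩
    ∑ (sublists L) f               ≡⟨ cong (λ L → ∑ (sublists L) f) (trans (∖-head L) (∖-∉ e∉L)) ⟨
    ∑ (sublists ((e ∷ L) ∖ e)) f   ∎
    where
    e∉L : e ∉ L
    e∉L e∈L = All.lookup x∉L e∈L refl
    e∉ : ∀ {F} → F ∈ sublists L → e ∉ F
    e∉ F∈ e∈F = e∉L (∈-sublists⇒⊆ F∈ e∈F)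
    ∖-head : ∀ F → (e ∷ F) ∖ e ≡ F ∖ e
    ∖-head F = filter-reject (λ f → ¬? (f ≟ˢ e)) (λ e≢e → e≢e refl)
    with-e : ∀ {F} → F ∈ sublists L → h (e ∷ F) ≡ f F
    with-e {F} F∈ rewrite ∖-head F | ∖-∉ (e∉ F∈) | dec-true (e ∈ˡ? (e ∷ F)) (here refl) = refl
  split (there e∈L) = begin
    (∑[ F ← sublists L ] h (x ∷ F)) +ᶻ ∑ (sublists L) h
      ≡⟨ cong (_+ᶻ ∑ (sublists L) h) (∑-cong {xs = sublists L} λ {F} _ →
           when-cong {p = e ∈ˡ? (x ∷ F)} {e ∈ˡ? F} (λ _ → cong f (∖-tail F))
           (mk⇔ (Any.tail (x≢e ∘ sym)) there)) ⟩
    (∑[ F ← sublists L ] (f (x ∷ (F ∖ e)) when e ∈ˡ? F)) +ᶻ ∑ (sublists L) h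
      ≡⟨ cong₂ _+ᶻ_ (∑-sublists-∋ (f ∘ (x ∷_)) uniq e∈L) (∑-sublists-∋ f uniq e∈L) ⟩
    ∑ (sublists (L ∖ e)) (f ∘ (x ∷_)) +ᶻ ∑ (sublists (L ∖ e)) f
      ≡⟨ ∑-sublists x (L ∖ e) ⟨
    ∑ (sublists (x ∷ (L ∖ e))) f
      ≡⟨ cong (λ L → ∑ (sublists L) f) (∖-tail L) ⟨
    ∑ (sublists ((x ∷ L) ∖ e)) f ∎
    where
    x≢e : x ≢ e
    x≢e refl = All.lookup x∉L e∈L refl
    ∖-tail : ∀ F → (x ∷ F) ∖ e ≡ x ∷ (F ∖ e)
    ∖-tail F = filter-accept (λ f → ¬? (f ≟ˢ e)) x≢e

-- Without duplicates, the deletion shortens `F` by exactly one.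
sign-∖ : ∀ {F} {e : Subset N} → Unique F → e ∈ F → sign F ≡ - sign (F ∖ e)
sign-∖ {F = x ∷ F} {e} (x∉F ∷ uniq) (here refl) = trans (ℤ.-1*i≡-i (sign F))
  (cong (λ G → - sign G) (sym (trans (filter-reject (λ f → ¬? (f ≟ˢ e)) (λ e≢e → e≢e refl))
    (∖-∉ λ e∈F → All.lookup x∉F e∈F refl))))
sign-∖ {F = x ∷ F} {e} (x∉F ∷ uniq) (there e∈F)
  rewrite filter-accept (λ f → ¬? (f ≟ˢ e)) {xs = F} (All.lookup x∉F e∈F) =
  trans (cong (ℤ.-1ℤ *ᶻ_) (sign-∖ uniq e∈F)) (sym (ℤ.neg-distribʳ-* ℤ.-1ℤ (sign (F ∖ e))))

-- The enumeration of all subsets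

subsets-unique : ∀ N → Unique (subsets N)
subsets-unique zero    = [] ∷ []
subsets-unique (suc N) = Unique.++⁺ (Unique.map⁺ Vec.∷-injectiveʳ (subsets-unique N))
  (Unique.map⁺ Vec.∷-injectiveʳ (subsets-unique N)) disjoint
  where
  disjoint : ∀ {S} → ¬ (S ∈ map (inside ∷ᵛ_) (subsets N) × S ∈ map (outside ∷ᵛ_) (subsets N))
  disjoint (p , q) with ∈-map⁻ _ p | ∈-map⁻ _ q
  ... | _ , _ , refl | _ , _ , ()

∈-subsets : (S : Subset N) → S ∈ subsets N
∈-subsets []ᵛ            = here refl
∈-subsets (inside  ∷ᵛ S) = ∈-++⁺ˡ (∈-map⁺ _ (∈-subsets S))
∈-subsets (outside ∷ᵛ S) = ∈-++⁺ʳ _ (∈-map⁺ _ (∈-subsets S))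

-- Disjoint blocks and factorisation of the signed count

PairwiseDisjoint : List (Subset N) → Set
PairwiseDisjoint = AllPairs (λ S T → Empty (S ∩ T))

same-block : ∀ {P : List (Subset N)} {S T v} → PairwiseDisjoint P →
             S ∈ P → T ∈ P → v ∈ₛ S → v ∈ₛ T → S ≡ T
same-block disj S∈P T∈P v∈S v∈T with ∈-AllPairs₂ disj S∈P T∈P
... | inj₁ S≡T         = S≡T
... | inj₂ (inj₁ S∩T≡∅) = contradiction (_ , x∈p∩q⁺ (v∈S , v∈T)) S∩T≡∅
... | inj₂ (inj₂ T∩S≡∅) = contradiction (_ , x∈p∩q⁺ (v∈T , v∈S)) T∩S≡∅

-- An edge inside both `B` and `T` would put one of its vertices in `B ∩ T`, so discarding the edges
-- inside `B` loses none inside `T`. An empty edge would break this.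
filter-⊆-disjoint : ∀ {B T : Subset N} {G} → Empty (B ∩ T) → All Nonempty G →
                    filter (_⊆? T) (filter (¬? ∘ (_⊆? B)) G) ≡ filter (_⊆? T) G
filter-⊆-disjoint B∩T≡∅ [] = refl
filter-⊆-disjoint {B = B} {T} {f ∷ G} B∩T≡∅ ((v , v∈f) ∷ nonempty) with f ⊆? B
... | no  _   with does (f ⊆? T)
...   | true  = cong (f ∷_) (filter-⊆-disjoint B∩T≡∅ nonempty)
...   | false = filter-⊆-disjoint B∩T≡∅ nonempty
filter-⊆-disjoint {B = B} {T} {f ∷ G} B∩T≡∅ ((v , v∈f) ∷ nonempty) | yes f⊆B = trans
  (filter-⊆-disjoint B∩T≡∅ nonempty)
  (sym (filter-reject (_⊆? T) λ f⊆T → B∩T≡∅ (v , x∈p∩q⁺ (f⊆B v∈f , f⊆T v∈f))))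

module Splitting {N} {C : Subset N → List (Subset N) → Set} (C? : ∀ B → Decidable (C B)) where

  -- The factorisation works for any condition `C B` on the edges inside a block `B`. It is applied
  -- with `C B F` saying that `F` connects `B`.
  Splits : List (Subset N) → List (Subset N) → Set
  Splits P G = All (λ f → Any (f ⊆_) P) G × All (λ B → C B (filter (_⊆? B) G)) P

  splits? : ∀ P G → Dec (Splits P G)
  splits? P G = All.all? (λ f → Any.any? (f ⊆?_) P) G ×-dec All.all? (λ B → C? B (filter (_⊆? B) G)) P

  -- The condition at `B` sees only the edges inside `B`, and the conditions at the other blocks see
  -- only the remaining ones, so the two conjuncts constrain complementary parts of `G`.
  splits-∷ : ∀ {B P G} → PairwiseDisjoint (B ∷ P) → All Nonempty G →
             Splits (B ∷ P) G ⇔ (C B (filter (_⊆? B) G) × Splits P (filter (¬? ∘ (_⊆? B)) G))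
  splits-∷ {B} {P} {G} (B∩P≡∅ ∷ _) nonempty = mk⇔
    (λ { (within , C-B ∷ C-P) → C-B
      , All.tabulate (λ f∈ → let f∈G , f⊈B = ∈-filter⁻ (¬? ∘ (_⊆? B)) f∈
                             in Any.tail f⊈B (All.lookup within f∈G))
      , All.tabulate (λ {T} T∈P → subst (C T) (sym (filter-T T∈P)) (All.lookup C-P T∈P)) })
    (λ (C-B , within , C-P) →
      All.tabulate (λ {f} f∈G → within-∷ within f∈G (f ⊆? B))
      , C-B ∷ All.tabulate (λ {T} T∈P → subst (C T) (filter-T T∈P) (All.lookup C-P T∈P)))
    where
    filter-T : ∀ {T} → T ∈ P → filter (_⊆? T) (filter (¬? ∘ (_⊆? B)) G) ≡ filter (_⊆? T) G
    filter-T T∈P = filter-⊆-disjoint (All.lookup B∩P≡∅ T∈P) nonempty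
    within-∷ : All (λ f → Any (f ⊆_) P) (filter (¬? ∘ (_⊆? B)) G) →
               ∀ {f} → f ∈ G → Dec (f ⊆ B) → Any (f ⊆_) (B ∷ P)
    within-∷ within f∈G (yes f⊆B) = here f⊆B
    within-∷ within f∈G (no  f⊈B) = there (All.lookup within (∈-filter⁺ (¬? ∘ (_⊆? B)) f∈G f⊈B))

  -- With no block to hold an edge, only the empty `G` survives, and its sign is the empty product.
  ∑-splits-[] : ∀ L → (∑[ G ← sublists L ] (sign G when splits? [] G)) ≡ ℤ.1ℤ
  ∑-splits-[] []      = refl
  ∑-splits-[] (f ∷ L) = trans (∑-sublists f L)
    (cong₂ _+ᶻ_ (∑-zero {xs = sublists L} λ {G} _ → when-no (sign (f ∷ G)) (splits? [] (f ∷ G)) λ { (() ∷ _ , _) })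
                (∑-splits-[] L))

  -- Induction on the blocks: both the sign and, by `splits-∷`, the guard are products over the
  -- edges inside and outside `B`, so `∑-sublists-filter` pulls out the factor of `B`.
  ∑-splits : ∀ {P L} → PairwiseDisjoint P → All Nonempty L →
             (∑[ G ← sublists L ] (sign G when splits? P G)) ≡
             (∏[ B ← P ] ∑[ F ← sublists (filter (_⊆? B) L) ] (sign F when C? B F))
  ∑-splits {[]}    {L} disj nonempty = ∑-splits-[] L
  ∑-splits {B ∷ P} {L} (B∩P≡∅ ∷ disj) nonempty = begin
    (∑[ G ← sublists L ] (sign G when splits? (B ∷ P) G))
      ≡⟨ ∑-cong separate ⟩
    (∑[ G ← sublists L ] (c (filter (_⊆? B) G) *ᶻ s (filter (¬? ∘ (_⊆? B)) G)))
      ≡⟨ ∑-sublists-filter (_⊆? B) c s L ⟩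
    ∑ (sublists (filter (_⊆? B) L)) c *ᶻ ∑ (sublists (filter (¬? ∘ (_⊆? B)) L)) s
      ≡⟨ cong (∑ (sublists (filter (_⊆? B) L)) c *ᶻ_) (∑-splits disj (All.filter⁺ (¬? ∘ (_⊆? B)) nonempty)) ⟩
    ∑ (sublists (filter (_⊆? B) L)) c *ᶻ
    (∏[ T ← P ] ∑[ F ← sublists (filter (_⊆? T) (filter (¬? ∘ (_⊆? B)) L)) ] (sign F when C? T F))
      -- The induction hypothesis speaks of `L` without the edges inside `B`; for the other blocks
      -- these make no difference.
      ≡⟨ cong (∑ (sublists (filter (_⊆? B) L)) c *ᶻ_) (∏-cong λ {T} T∈P →
           cong (λ L → ∑[ F ← sublists L ] (sign F when C? T F))
             (filter-⊆-disjoint (All.lookup B∩P≡∅ T∈P) nonempty)) ⟩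
    ∑ (sublists (filter (_⊆? B) L)) c *ᶻ
    (∏[ T ← P ] ∑[ F ← sublists (filter (_⊆? T) L) ] (sign F when C? T F)) ∎
    where
    c s : List (Subset N) → ℤ
    c F = sign F when C? B F
    s F = sign F when splits? P F
    separate : ∀ {G} → G ∈ sublists L → (sign G when splits? (B ∷ P) G) ≡
               c (filter (_⊆? B) G) *ᶻ s (filter (¬? ∘ (_⊆? B)) G)
    separate {G} G∈ = trans
      (when-cong {p = splits? (B ∷ P) G} {C? B F₁ ×-dec splits? P F₂}
        (λ _ → sym (sign-filter (_⊆? B) G))
        (splits-∷ (B∩P≡∅ ∷ disj) (All.tabulate (All.lookup nonempty ∘ ∈-sublists⇒⊆ G∈))))
      (sym (when-* (sign F₁) (sign F₂) (C? B F₁) (splits? P F₂)))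
      where
      F₁ = filter (_⊆? B) G
      F₂ = filter (¬? ∘ (_⊆? B)) G

-- Counting in lists, unions and characteristic vectors

length-filter-¬ : ∀ {P : A → Set} (P? : Decidable P) xs →
                  length (filter P? xs) + length (filter (¬? ∘ P?) xs) ≡ length xs
length-filter-¬ P? []       = refl
length-filter-¬ P? (x ∷ xs) with does (P? x)
... | true  = cong suc (length-filter-¬ P? xs)
... | false = trans (ℕ.+-suc _ _) (cong suc (length-filter-¬ P? xs))

-- This serves to identify the components of `F` and of `F ∖ e` that miss `e`: being a component of
-- one or of the other is equivalent only for such sets.
filter-filter-cong : ∀ {P Q R : A → Set} (P? : Decidable P) (Q? : Decidable Q) (R? : Decidable R) →
                     (∀ {x} → R x → P x ⇔ Q x) → ∀ xs →
                     filter R? (filter P? xs) ≡ filter R? (filter Q? xs)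
filter-filter-cong P? Q? R? P⇔Q []       = refl
filter-filter-cong P? Q? R? P⇔Q (x ∷ xs) with R? x
... | yes Rx rewrite does-⇔ (P⇔Q Rx) (P? x) (Q? x) with does (Q? x)
...   | true  = trans (filter-accept R? Rx)
                  (trans (cong (x ∷_) (filter-filter-cong P? Q? R? P⇔Q xs)) (sym (filter-accept R? Rx)))
...   | false = filter-filter-cong P? Q? R? P⇔Q xs
filter-filter-cong P? Q? R? P⇔Q (x ∷ xs) | no ¬Rx =
  trans (drop P?) (trans (filter-filter-cong P? Q? R? P⇔Q xs) (sym (drop Q?)))
  where
  drop : ∀ {S : _ → Set} (S? : Decidable S) → filter R? (filter S? (x ∷ xs)) ≡ filter R? (filter S? xs)
  drop S? with does (S? x)
  ... | true  = filter-reject R? ¬Rx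
  ... | false = refl

length≡1 : ∀ {xs : List A} {y} → Unique xs → y ∈ xs → (∀ {x} → x ∈ xs → x ≡ y) → length xs ≡ 1
length≡1 {xs = x ∷ []}     uniq y∈xs all≡y = refl
length≡1 {xs = x ∷ z ∷ xs} ((x≢z ∷ _) ∷ _) y∈xs all≡y =
  contradiction (trans (all≡y (here refl)) (sym (all≡y (there (here refl))))) x≢z

length≡1⇒≡ : ∀ {xs : List A} {x y} → length xs ≡ 1 → x ∈ xs → y ∈ xs → x ≡ y
length≡1⇒≡ {xs = x ∷ []} refl (here refl) (here refl) = refl

∈-⋃⁺ : ∀ {P : List (Subset N)} {v S} → S ∈ P → v ∈ₛ S → v ∈ₛ ⋃ P
∈-⋃⁺ (here refl) v∈S = x∈p∪q⁺ (inj₁ v∈S)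
∈-⋃⁺ (there S∈P) v∈S = x∈p∪q⁺ (inj₂ (∈-⋃⁺ S∈P v∈S))

∈-⋃⁻ : ∀ (P : List (Subset N)) {v} → v ∈ₛ ⋃ P → ∃ λ S → S ∈ P × v ∈ₛ S
∈-⋃⁻ []      v∈⊥ = contradiction v∈⊥ ∉⊥
∈-⋃⁻ (S ∷ P) v∈∪ with x∈p∪q⁻ S (⋃ P) v∈∪
... | inj₁ v∈S = S , here refl , v∈S
... | inj₂ v∈⋃ = let T , T∈P , v∈T = ∈-⋃⁻ P v∈⋃ in T , there T∈P , v∈T

∈-tabulate-does : ∀ {P : Fin N → Set} (P? : Decidable P) {v} → v ∈ₛ tabulate (does ∘ P?) ⇔ P v
∈-tabulate-does P? {v} = mk⇔
  (λ v∈ → invert (trans (sym (Vec.lookup∘tabulate (does ∘ P?) v)) (Vec.[]=⇒lookup v∈)))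
  (λ Pv → Vec.lookup⇒[]= v _ (trans (Vec.lookup∘tabulate (does ∘ P?) v) (dec-true (P? v) Pv)))
  where
  invert : does (P? v) ≡ true → _
  invert eq with P? v
  ... | yes Pv = Pv

-- Connectedness and components

connected-sym : ∀ {F : List (Subset N)} {v w} → Connected F v w → Connected F w v
connected-sym {F = F} = EqClosure.symmetric (Neighbours F)

connected-mono : ∀ {F G : List (Subset N)} → (∀ {f} → f ∈ F → f ∈ G) →
                 ∀ {v w} → Connected F v w → Connected G v w
connected-mono F⊆G = EqClosure.map λ (v≢w , v~w) →
  let f , f∈F , v∈f×w∈f = find v~w in v≢w , lose (F⊆G f∈F) v∈f×w∈f

edge-connected : ∀ {F : List (Subset N)} {f v w} → f ∈ F → v ∈ₛ f → w ∈ₛ f → Connected F v w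
edge-connected {v = v} {w} f∈F v∈f w∈f with v Fin.≟ w
... | yes refl = ε
... | no  v≢w  = EqClosure.return (v≢w , lose f∈F (v∈f , w∈f))

-- An invariant of single edges is carried along a path. Backward steps need no separate hypothesis,
-- because the two vertices play symmetric roles in an edge.
connected-closed : ∀ {F : List (Subset N)} {T : Fin N → Set} →
                   (∀ {f u w} → f ∈ F → u ∈ₛ f → w ∈ₛ f → T u → T w) →
                   ∀ {v w} → Connected F v w → T v → T w
connected-closed closed ε Tv = Tv
connected-closed closed (fwd (_ , u~w) ◅ p) Tv =
  let _ , f∈F , u∈f , w∈f = find u~w in connected-closed closed p (closed f∈F u∈f w∈f Tv)
connected-closed closed (bwd (_ , w~u) ◅ p) Tv =
  let _ , f∈F , w∈f , u∈f = find w~u in connected-closed closed p (closed f∈F u∈f w∈f Tv)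

class : List (Subset N) → Fin N → Subset N
class F v = tabulate (does ∘ connected? F v)

∈-class : ∀ (F : List (Subset N)) v {w} → w ∈ₛ class F v ⇔ Connected F v w
∈-class F v = ∈-tabulate-does (connected? F v)

v∈class : ∀ (F : List (Subset N)) v → v ∈ₛ class F v
v∈class F v = Equivalence.from (∈-class F v) ε

components-unique : (H : Hypergraph N) → Unique (components H)
components-unique {N} H = Unique.filter⁺ (isComponent? H) (subsets-unique N)

∈-components : {H : Hypergraph N} {S : Subset N} → S ∈ components H ⇔ IsComponent H S
∈-components {H = H} {S} = mk⇔
  (proj₂ ∘ ∈-filter⁻ (isComponent? H) {xs = subsets _})
  (∈-filter⁺ (isComponent? H) (∈-subsets S))

module _ {V : Subset N} {F : List (Subset N)} where

  open Equivalence

  component-connected : ∀ {S v w} → IsComponent ⟨ V , F ⟩ S → v ∈ₛ S → w ∈ₛ S → Connected F v w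
  component-connected (_ , _ , S⇔) v∈S w∈S = connected-sym (to (S⇔ _) v∈S) ◅◅ to (S⇔ _) w∈S

  component-closed : ∀ {S v w} → IsComponent ⟨ V , F ⟩ S → v ∈ₛ S → Connected F v w → w ∈ₛ S
  component-closed (_ , _ , S⇔) v∈S v~w = from (S⇔ _) (to (S⇔ _) v∈S ◅◅ v~w)

  component-nonempty : ∀ {S} → IsComponent ⟨ V , F ⟩ S → Nonempty S
  component-nonempty (v , _ , S⇔) = v , from (S⇔ v) ε

  component-≡ : ∀ {S T v} → IsComponent ⟨ V , F ⟩ S → IsComponent ⟨ V , F ⟩ T →
                v ∈ₛ S → v ∈ₛ T → S ≡ T
  component-≡ cS cT v∈S v∈T = ⊆-antisym
    (λ w∈S → component-closed cT v∈T (component-connected cS v∈S w∈S))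
    (λ w∈T → component-closed cS v∈S (component-connected cT v∈T w∈T))

  class-isComponent : ∀ {v} → v ∈ₛ V → IsComponent ⟨ V , F ⟩ (class F v)
  class-isComponent {v} v∈V = v , v∈V , λ w → ∈-class F v

  class∈components : ∀ {v} → v ∈ₛ V → class F v ∈ components ⟨ V , F ⟩
  class∈components v∈V = from ∈-components (class-isComponent v∈V)

  component-⊆ : All (_⊆ V) F → ∀ {S} → IsComponent ⟨ V , F ⟩ S → S ⊆ V
  component-⊆ F⊆V (v , v∈V , S⇔) {w} w∈S =
    connected-closed {T = _∈ₛ V} (λ f∈F _ w∈f _ → All.lookup F⊆V f∈F w∈f) (to (S⇔ w) w∈S) v∈V

  components-isDecomposition : All (_⊆ V) F → IsDecomposition V (components ⟨ V , F ⟩)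
  components-isDecomposition F⊆V = record
    { nonempty = All.map component-nonempty all-components
    ; disjoint = disjoint all-components (components-unique ⟨ V , F ⟩)
    ; covers   = ⊆-antisym
      (λ v∈⋃ → let S , S∈ , v∈S = ∈-⋃⁻ _ v∈⋃ in component-⊆ F⊆V (to ∈-components S∈) v∈S)
      (λ {v} v∈V → ∈-⋃⁺ (class∈components v∈V) (v∈class F v))
    }
    where
    all-components = All.all-filter (isComponent? ⟨ V , F ⟩) (subsets N)
    disjoint : ∀ {P} → All (IsComponent ⟨ V , F ⟩) P → Unique P → PairwiseDisjoint P
    disjoint []         []           = []
    disjoint (cS ∷ cP) (S∉P ∷ uniq) =
      All.zipWith (λ (cT , S≢T) (v , v∈) → let v∈S , v∈T = x∈p∩q⁻ _ _ v∈
                                           in S≢T (component-≡ cS cT v∈S v∈T)) (cP , S∉P)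
      ∷ disjoint cP uniq

  -- No component is missing from `P`: its base vertex lies in some block, and that block is a
  -- component sharing a vertex with it, hence equal to it. Having the same members, the two
  -- sublists of `subsets N` coincide.
  all-components⇒≡ : ∀ {P} → P ∈ sublists (subsets N) → IsDecomposition V P →
                     All (IsComponent ⟨ V , F ⟩) P → P ≡ components ⟨ V , F ⟩
  all-components⇒≡ {P} P∈ (isDecomposition _ _ covers) cP =
    ∈-sublists⇒≡filter (isComponent? ⟨ V , F ⟩) (subsets-unique N) P∈ λ _ → mk⇔ (All.lookup cP) component∈P
    where
    component∈P : ∀ {S} → IsComponent ⟨ V , F ⟩ S → S ∈ P
    component∈P {S} cS@(v , v∈V , S⇔) with ∈-⋃⁻ P (subst (v ∈ₛ_) (sym covers) v∈V)
    ... | T , T∈P , v∈T = subst (_∈ P) (component-≡ (All.lookup cP T∈P) cS v∈T (from (S⇔ v) ε)) T∈P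

  k≡1⇒nonempty : length (components ⟨ V , F ⟩) ≡ 1 → Nonempty V
  k≡1⇒nonempty k≡1 with components ⟨ V , F ⟩ | All.all-filter (isComponent? ⟨ V , F ⟩) (subsets N)
  ... | S ∷ [] | (v , v∈V , _) ∷ [] = v , v∈V

  k≡1⇒connected : length (components ⟨ V , F ⟩) ≡ 1 → ∀ {v w} → v ∈ₛ V → w ∈ₛ V → Connected F v w
  k≡1⇒connected k≡1 {v} {w} v∈V w∈V = to (∈-class F v)
    (subst (w ∈ₛ_) (length≡1⇒≡ k≡1 (class∈components w∈V) (class∈components v∈V)) (v∈class F w))

  connected⇒k≡1 : Nonempty V → (∀ {v w} → v ∈ₛ V → w ∈ₛ V → Connected F v w) →
                  length (components ⟨ V , F ⟩) ≡ 1
  connected⇒k≡1 (v , v∈V) conn = length≡1 (components-unique ⟨ V , F ⟩) (class∈components v∈V) λ {S} S∈ →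
    let cS@(u , u∈V , S⇔) = to (∈-components {H = ⟨ V , F ⟩}) S∈
    in component-≡ cS (class-isComponent v∈V) (from (S⇔ u) ε) (from (∈-class F v) (conn v∈V u∈V))

-- Recognising the decomposition into components

module _ (H : Hypergraph N) where

  open Equivalence
  open Splitting (λ B F → k (H [ B ]) F ℕ.≟ 1)

  -- Forwards, an edge touching a component lies inside it, so paths within a component use only its
  -- own edges. Backwards, an edge touching a block `S` lies in some block, which must be `S` by
  -- disjointness; hence no path leaves `S`, and `k ≡ 1` makes `S` non-empty and connected.
  components⇔splits : ∀ {P G} → IsDecomposition (V H) P → All (_⊆ V H) G → All Nonempty G →
                      All (IsComponent ⟨ V H , G ⟩) P ⇔ Splits P G
  components⇔splits {P} {G} (isDecomposition nonempty disjoint covers) G⊆V G≢∅ =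
    mk⇔ (λ cP → All.tabulate (within cP) , All.map k≡1 cP)
        (λ (within , k≡1) → All.tabulate λ S∈P → component within S∈P (All.lookup k≡1 S∈P))
    where
    within : All (IsComponent ⟨ V H , G ⟩) P → ∀ {f} → f ∈ G → Any (f ⊆_) P
    within cP f∈G with All.lookup G≢∅ f∈G
    ... | v , v∈f with ∈-⋃⁻ P (subst (v ∈ₛ_) (sym covers) (All.lookup G⊆V f∈G v∈f))
    ...   | S , S∈P , v∈S = lose S∈P λ w∈f →
      component-closed (All.lookup cP S∈P) v∈S (edge-connected f∈G v∈f w∈f)

    k≡1 : ∀ {S} → IsComponent ⟨ V H , G ⟩ S → k (H [ S ]) (filter (_⊆? S) G) ≡ 1
    k≡1 {S} cS = connected⇒k≡1 (component-nonempty cS) λ {v} v∈S w∈S → proj₂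
      -- Membership in `S` belongs to the invariant because it is what forces the next edge of the
      -- path to lie inside `S`.
      (connected-closed {T = λ u → u ∈ₛ S × Connected (filter (_⊆? S) G) v u} step
        (component-connected cS v∈S w∈S) (v∈S , ε))
      where
      step : ∀ {v f u w} → f ∈ G → u ∈ₛ f → w ∈ₛ f →
             u ∈ₛ S × Connected (filter (_⊆? S) G) v u → w ∈ₛ S × Connected (filter (_⊆? S) G) v w
      step {f = f} f∈G u∈f w∈f (u∈S , v~u) =
        f⊆S w∈f , v~u ◅◅ edge-connected (∈-filter⁺ (_⊆? S) f∈G f⊆S) u∈f w∈f
        where
        f⊆S : f ⊆ S
        f⊆S x∈f = component-closed cS u∈S (edge-connected f∈G u∈f x∈f)

    component : All (λ f → Any (f ⊆_) P) G → ∀ {S} → S ∈ P →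
                k (H [ S ]) (filter (_⊆? S) G) ≡ 1 → IsComponent ⟨ V H , G ⟩ S
    component within {S} S∈P k≡1 with k≡1⇒nonempty k≡1
    ... | v , v∈S = v , subst (v ∈ₛ_) covers (∈-⋃⁺ S∈P v∈S) , λ w → mk⇔
      (λ w∈S → connected-mono (proj₁ ∘ ∈-filter⁻ (_⊆? S)) (k≡1⇒connected k≡1 v∈S w∈S))
      (λ v~w → connected-closed {T = _∈ₛ S} step v~w v∈S)
      where
      step : ∀ {f u w} → f ∈ G → u ∈ₛ f → w ∈ₛ f → u ∈ₛ S → w ∈ₛ S
      step f∈G u∈f w∈f u∈S with find (All.lookup within f∈G)
      ... | T , T∈P , f⊆T = subst (_ ∈ₛ_) (same-block disjoint T∈P S∈P (f⊆T u∈f) u∈S) (f⊆T w∈f)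

-- Components before and after deleting an edge

∈-∖⁺ : ∀ {F} {e f : Subset N} → f ∈ F → f ≢ e → f ∈ F ∖ e
∈-∖⁺ {e = e} = ∈-filter⁺ (λ f → ¬? (f ≟ˢ e))

∈-∖⁻ : ∀ {F} {e f : Subset N} → f ∈ F ∖ e → f ∈ F
∈-∖⁻ {e = e} = proj₁ ∘ ∈-filter⁻ (λ f → ¬? (f ≟ˢ e))

module _ (H : Hypergraph N) {F : List (Subset N)} {e : Subset N} where

  open Equivalence

  -- A path starting in `S` stays in `S`, so each edge it uses has a vertex in `S` and cannot be
  -- `e`.
  component-∖ : ∀ {S} → Empty (e ∩ S) → IsComponent ⟨ V H , F ⟩ S ⇔ IsComponent ⟨ V H , F ∖ e ⟩ S
  component-∖ {S} e∩S≡∅ = mk⇔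
    (λ cS@(v , v∈V , S⇔) → v , v∈V , λ w → mk⇔
      (λ w∈S → proj₂ (connected-closed {T = λ u → u ∈ₛ S × Connected (F ∖ e) v u}
        (λ f∈F u∈f w∈f (u∈S , v~u) →
          component-closed cS u∈S (edge-connected f∈F u∈f w∈f)
          , v~u ◅◅ edge-connected (f∈F∖e f∈F u∈f u∈S) u∈f w∈f)
        (to (S⇔ w) w∈S) (from (S⇔ v) ε , ε)))
      (from (S⇔ w) ∘ connected-mono ∈-∖⁻))
    (λ cS@(v , v∈V , S⇔) → v , v∈V , λ w → mk⇔
      (connected-mono ∈-∖⁻ ∘ to (S⇔ w))
      (λ v~w → connected-closed {T = _∈ₛ S}
        (λ f∈F u∈f w∈f u∈S → component-closed cS u∈S (edge-connected (f∈F∖e f∈F u∈f u∈S) u∈f w∈f))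
        v~w (from (S⇔ v) ε)))
    where
    f∈F∖e : ∀ {f u} → f ∈ F → u ∈ₛ f → u ∈ₛ S → f ∈ F ∖ e
    f∈F∖e f∈F u∈f u∈S = ∈-∖⁺ f∈F λ { refl → e∩S≡∅ (_ , x∈p∩q⁺ (u∈f , u∈S)) }

  -- Components missing `e` are the same for `F` and `F ∖ e`, while exactly one component of `F`
  -- meets `e`. The additive form avoids truncated subtraction.
  k+meets : e ∈ F → Nonempty e → e ⊆ V H →
            k H F + meets e (components ⟨ V H , F ∖ e ⟩) ≡ suc (k H (F ∖ e))
  k+meets e∈F (a , a∈e) e⊆V = begin
    k H F + meets e cG                 ≡⟨ cong (_+ meets e cG) (length-filter-¬ meets? cF) ⟨
    length (filter meets? cF) + length (filter (¬? ∘ meets?) cF) + meets e cG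
      ≡⟨ cong₂ (λ m n → m + length n + meets e cG) one
           (filter-filter-cong (isComponent? ⟨ V H , F ⟩) (isComponent? ⟨ V H , F ∖ e ⟩)
             (¬? ∘ meets?) component-∖ (subsets N)) ⟩
    suc (length (filter (¬? ∘ meets?) cG) + meets e cG)
      ≡⟨ cong suc (ℕ.+-comm (length (filter (¬? ∘ meets?) cG)) _) ⟩
    suc (meets e cG + length (filter (¬? ∘ meets?) cG))
      ≡⟨ cong suc (length-filter-¬ meets? cG) ⟩
    suc (k H (F ∖ e)) ∎
    where
    cF = components ⟨ V H , F ⟩
    cG = components ⟨ V H , F ∖ e ⟩
    meets? : Decidable (λ S → Nonempty (e ∩ S))
    meets? S = nonempty? (e ∩ S)
    -- The component in question is the class of `a`: any component meeting `e` contains a vertex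
    -- joined to `a` by `e` itself.
    one : length (filter meets? cF) ≡ 1
    one = length≡1 (Unique.filter⁺ meets? (components-unique ⟨ V H , F ⟩))
      (∈-filter⁺ meets? (class∈components (e⊆V a∈e)) (a , x∈p∩q⁺ (a∈e , v∈class F a)))
      λ S∈ → let S∈cF , (u , u∈) = ∈-filter⁻ meets? S∈
                 u∈e , u∈S = x∈p∩q⁻ e _ u∈
             in component-≡ (to ∈-components S∈cF) (class-isComponent (e⊆V a∈e)) u∈S
                  (from (∈-class F a) (edge-connected e∈F a∈e u∈e))

-- Blocks met by an edge

1≤∣S∣⇒nonempty : ∀ {S : Subset N} → 1 ≤ ∣ S ∣ → Nonempty S
1≤∣S∣⇒nonempty {N} {S} 1≤∣S∣ with nonempty? S
... | yes S≢∅ = S≢∅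
... | no  S≡∅ = contradiction (trans (cong ∣_∣ (Empty-unique S≡∅)) (∣⊥∣≡0 N)) (ℕ.>⇒≢ 1≤∣S∣)

equal-blocks⇒length≤1 : ∀ {P : List (Subset N)} {B} → PairwiseDisjoint P → All Nonempty P →
                        (∀ {S} → S ∈ P → S ≡ B) → length P ≤ 1
equal-blocks⇒length≤1 []            _ _ = z≤n
equal-blocks⇒length≤1 ([] ∷ [])     _ _ = s≤s z≤n
equal-blocks⇒length≤1 ((S∩T≡∅ ∷ _) ∷ _) ((v , v∈S) ∷ _) P≡B =
  contradiction (v , x∈p∩q⁺ (v∈S , subst (v ∈ₛ_) (trans (P≡B (here refl)) (sym (P≡B (there (here refl))))) v∈S)) S∩T≡∅

-- If `e` were inside `B`, every block meeting `e` would share a vertex with `B` and so be `B`,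
-- leaving only one such block.
meets-twice⇒⊈ : ∀ {P} {e B : Subset N} → PairwiseDisjoint P → B ∈ P → 2 ≤ meets e P → ¬ e ⊆ B
meets-twice⇒⊈ {P = P} {e} {B} disjoint B∈P 2≤meets e⊆B = ℕ.<⇒≱ 2≤meets
  (equal-blocks⇒length≤1 (AllPairs.filter⁺ meets? disjoint)
    (All.map (λ {S} (v , v∈) → v , proj₂ (x∈p∩q⁻ e S v∈)) (All.all-filter meets? P))
    λ {S} S∈ → let S∈P , (v , v∈) = ∈-filter⁻ meets? {xs = P} S∈
                   v∈e , v∈S      = x∈p∩q⁻ e S v∈
               in same-block disjoint S∈P B∈P v∈S (e⊆B v∈e))
  where
  meets? : Decidable (λ S → Nonempty (e ∩ S))
  meets? S = nonempty? (e ∩ S)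

filter-⊆-∖ : ∀ {e B : Subset N} → ¬ e ⊆ B → ∀ L → filter (_⊆? B) (L ∖ e) ≡ filter (_⊆? B) L
filter-⊆-∖ {e = e} {B} e⊈B []      = refl
filter-⊆-∖ {e = e} {B} e⊈B (f ∷ L) with f ≟ˢ e
... | yes refl = trans (filter-⊆-∖ e⊈B L) (sym (filter-reject (_⊆? B) e⊈B))
... | no  _ with does (f ⊆? B)
...   | true  = cong (f ∷_) (filter-⊆-∖ e⊈B L)
...   | false = filter-⊆-∖ e⊈B L

-- Evaluation of the signed count

module _ (H : Hypergraph N) (isH : IsHypergraph H) (e : Subset N) (e∈E : e ∈ E H) where

  open IsHypergraph isH
  open Splitting (λ B F → k (H [ B ]) F ℕ.≟ 1)

  edge-nonempty : All Nonempty (E H)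
  edge-nonempty = All.map (1≤∣S∣⇒nonempty ∘ ℕ.<⇒≤) 2≤∣E∣

  Contributes : ℕ → ℕ → List (Subset N) → Set
  Contributes j m G = k H G ≡ j × meets e (components ⟨ V H , G ⟩) ≡ m

  contributes? : ∀ j m → Decidable (Contributes j m)
  contributes? j m G = k H G ℕ.≟ j ×-dec meets e (components ⟨ V H , G ⟩) ℕ.≟ m

  -- This repeats the test inside `decompositions`, so that `∑-filter` applies to that list by
  -- definition.
  decomposes? : ∀ j m → Decidable (λ P → IsDecomposition (V H) P × length P ≡ j × meets e P ≡ m)
  decomposes? j m P = isDecomposition? (V H) P ×-dec (length P ℕ.≟ j) ×-dec (meets e P ℕ.≟ m)

  -- Once `k H (F ∖ e)` is `j`, `k+meets` says that `k H F` and the number of components met add up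
  -- to `suc j`, which is also `i + (j ∸ i + 1)`. Cancelling either summand determines the other;
  -- `i < j` makes the subtraction exact.
  k-∖⇔contributes : ∀ {i j F} → i < j → e ∈ F →
               (k H F ≡ i × k H (F ∖ e) ≡ j) ⇔ Contributes j (j ∸ i + 1) (F ∖ e)
  k-∖⇔contributes {i} {j} {F} i<j e∈F = mk⇔
    (λ { (refl , refl) → refl , ℕ.+-cancelˡ-≡ (k H F) _ _ (trans count (sym total)) })
    (λ { (refl , meets≡) → ℕ.+-cancelʳ-≡ (k H (F ∖ e) ∸ i + 1) (k H F) i
           (trans (cong (k H F +_) (sym meets≡)) (trans count (sym total))) , refl })
    where
    count = k+meets H e∈F (All.lookup edge-nonempty e∈E) (All.lookup E⊆V e∈E)
    total : i + (j ∸ i + 1) ≡ suc j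
    total = begin
      i + (j ∸ i + 1) ≡⟨ ℕ.+-assoc i (j ∸ i) 1 ⟨
      i + (j ∸ i) + 1 ≡⟨ cong (_+ 1) (ℕ.m+[n∸m]≡n (ℕ.<⇒≤ i<j)) ⟩
      j + 1           ≡⟨ ℕ.+-comm j 1 ⟩
      suc j           ∎

  b≡-∑-contributes : ∀ {i j} → i < j →
                b H e i j ≡ - (∑[ G ← sublists (E H ∖ e) ] (sign G when contributes? j (j ∸ i + 1) G))
  b≡-∑-contributes {i} {j} i<j = begin
    b H e i j
      ≡⟨ ∑-filter {f = sign} (λ F → (e ∈ˡ? F) ×-dec (k H F ℕ.≟ i) ×-dec (k H (F ∖ e) ℕ.≟ j)) (sublists (E H)) ⟩
    (∑[ F ← sublists (E H) ] (sign F when (e ∈ˡ? F) ×-dec (k H F ℕ.≟ i) ×-dec (k H (F ∖ e) ℕ.≟ j)))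
      ≡⟨ ∑-cong (λ {F} F∈ → trans
           (when-cong {p = (e ∈ˡ? F) ×-dec (k H F ℕ.≟ i) ×-dec (k H (F ∖ e) ℕ.≟ j)}
                      {q = e ∈ˡ? F ×-dec contributes? j m (F ∖ e)}
             (λ (e∈F , _) → sign-∖ (∈-sublists⇒unique E-unique F∈) e∈F)
             (mk⇔ (λ (e∈F , p) → e∈F , Equivalence.to   (k-∖⇔contributes i<j e∈F) p)
                  (λ (e∈F , p) → e∈F , Equivalence.from (k-∖⇔contributes i<j e∈F) p)))
           -- Nesting the guards leaves an inner term that depends on `F` only through `F ∖ e`, as
           -- `∑-sublists-∋` requires.
           (sym (when-× (- sign (F ∖ e)) (contributes? j m (F ∖ e)) (e ∈ˡ? F)))) ⟩
    (∑[ F ← sublists (E H) ] ((- sign (F ∖ e) when contributes? j m (F ∖ e)) when e ∈ˡ? F))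
      ≡⟨ ∑-sublists-∋ (λ G → - sign G when contributes? j m G) E-unique e∈E ⟩
    (∑[ G ← sublists (E H ∖ e) ] (- sign G when contributes? j m G))
      ≡⟨ ∑-cong {xs = sublists (E H ∖ e)} (λ {G} _ → when-neg (sign G) (contributes? j m G)) ⟩
    (∑[ G ← sublists (E H ∖ e) ] (- (sign G when contributes? j m G)))
      ≡⟨ ∑-neg (sublists (E H ∖ e)) ⟩
    - (∑[ G ← sublists (E H ∖ e) ] (sign G when contributes? j m G)) ∎
    where m = j ∸ i + 1

  -- By `components⇔splits`, the only `P` that can pass the guard is the list of components of `G`.
  contributes≡∑-decompositions : ∀ {j m G} → All (_∈ E H) G →
    (sign G when contributes? j m G) ≡
    (∑[ P ← sublists (subsets N) ] (sign G when decomposes? j m P ×-dec splits? P G))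
  contributes≡∑-decompositions {j} {m} {G} G⊆E = sym (begin
    (∑[ P ← sublists (subsets N) ] (sign G when decomposes? j m P ×-dec splits? P G))
      ≡⟨ ∑-when-unique (λ P → decomposes? j m P ×-dec splits? P G) (sign G) (sublists-unique (subsets-unique N))
           (filter∈sublists (isComponent? ⟨ V H , G ⟩) (subsets N))
           (λ { P∈ ((dec , _) , splits) →
                all-components⇒≡ P∈ dec (Equivalence.from (components⇔splits H dec G⊆V G≢∅) splits) }) ⟩
    (sign G when decomposes? j m cG ×-dec splits? cG G)
      -- As `k H G` unfolds to `length cG`, the numerical conditions on both sides are literally the
      -- same.
      ≡⟨ when-cong {p = decomposes? j m cG ×-dec splits? cG G} {q = contributes? j m G} (λ _ → refl) (mk⇔
           (λ ((_ , p) , _) → p)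
           (λ p → (cG-dec , p) , Equivalence.to (components⇔splits H cG-dec G⊆V G≢∅)
             (All.all-filter (isComponent? ⟨ V H , G ⟩) (subsets N)))) ⟩
    (sign G when contributes? j m G) ∎)
    where
    cG = components ⟨ V H , G ⟩
    G⊆V : All (_⊆ V H) G
    G⊆V = All.map (All.lookup E⊆V) G⊆E
    G≢∅ : All Nonempty G
    G≢∅ = All.map (All.lookup edge-nonempty) G⊆E
    cG-dec = components-isDecomposition G⊆V

  -- The factors from `∑-splits` range over edges inside a block other than `e`; as `e` lies in no
  -- block, these are all the edges of `H [ B ]`.
  ∑-splits≡∏-a₁ : ∀ {P} → IsDecomposition (V H) P → 2 ≤ meets e P →
                  (∑[ G ← sublists (E H ∖ e) ] (sign G when splits? P G)) ≡ (∏[ B ← P ] a₁ (H [ B ]))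
  ∑-splits≡∏-a₁ {P} (isDecomposition _ disjoint _) 2≤meets = begin
    (∑[ G ← sublists (E H ∖ e) ] (sign G when splits? P G))
      ≡⟨ ∑-splits disjoint (All.filter⁺ (λ f → ¬? (f ≟ˢ e)) edge-nonempty) ⟩
    (∏[ B ← P ] ∑[ F ← sublists (filter (_⊆? B) (E H ∖ e)) ] (sign F when k (H [ B ]) F ℕ.≟ 1))
      ≡⟨ ∏-cong (λ {B} B∈P → trans
           (cong (λ L → ∑[ F ← sublists L ] (sign F when k (H [ B ]) F ℕ.≟ 1))
             (filter-⊆-∖ (meets-twice⇒⊈ disjoint B∈P 2≤meets) (E H)))
           (sym (∑-filter {f = sign} (λ F → k (H [ B ]) F ℕ.≟ 1) (sublists (E (H [ B ])))))) ⟩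
    (∏[ B ← P ] a₁ (H [ B ])) ∎

  ∑-contributes≡∑-decompositions : ∀ {j m} → 2 ≤ m →
    (∑[ G ← sublists (E H ∖ e) ] (sign G when contributes? j m G)) ≡
    (∑[ P ← decompositions (V H) e j m ] ∏[ B ← P ] a₁ (H [ B ]))
  ∑-contributes≡∑-decompositions {j} {m} 2≤m = begin
    (∑[ G ← sublists (E H ∖ e) ] (sign G when contributes? j m G))
      ≡⟨ ∑-cong (λ G∈ → contributes≡∑-decompositions (All.tabulate (∈-∖⁻ ∘ ∈-sublists⇒⊆ G∈))) ⟩
    (∑[ G ← sublists (E H ∖ e) ] ∑[ P ← 𝓟 ] (sign G when decomposes? j m P ×-dec splits? P G))
      ≡⟨ ∑-swap (sublists (E H ∖ e)) 𝓟 (λ G P → sign G when decomposes? j m P ×-dec splits? P G) ⟩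
    (∑[ P ← 𝓟 ] ∑[ G ← sublists (E H ∖ e) ] (sign G when decomposes? j m P ×-dec splits? P G))
      ≡⟨ ∑-cong {xs = 𝓟} (λ {P} _ → trans
           (∑-cong {xs = sublists (E H ∖ e)} λ {G} _ → sym (when-× (sign G) (splits? P G) (decomposes? j m P)))
           (∑-when (sublists (E H ∖ e)) (decomposes? j m P))) ⟩
    (∑[ P ← 𝓟 ] ((∑[ G ← sublists (E H ∖ e) ] (sign G when splits? P G)) when decomposes? j m P))
      -- The value changes only under the guard, which supplies the disjointness of the blocks and
      -- `meets e P ≡ m`.
      ≡⟨ ∑-cong {xs = 𝓟} (λ {P} _ → when-cong {p = decomposes? j m P} {q = decomposes? j m P}
           (λ (dec , _ , meets≡m) → ∑-splits≡∏-a₁ dec (subst (2 ≤_) (sym meets≡m) 2≤m)) (mk⇔ id id)) ⟩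
    (∑[ P ← 𝓟 ] ((∏[ B ← P ] a₁ (H [ B ])) when decomposes? j m P))
      ≡⟨ ∑-filter (decomposes? j m) 𝓟 ⟨
    (∑[ P ← decompositions (V H) e j m ] ∏[ B ← P ] a₁ (H [ B ])) ∎
    where 𝓟 = sublists (subsets N)

proposition3p3 : ∀ {N : ℕ} (H : Hypergraph N) → IsHypergraph H →
    ∀ (e : Subset N) → e ∈ E H →
    ∀ (i j : ℕ) → 1 ≤ i → i < j → j ≤ ∣ V H ∣ →
    b H e i j ≡
    - (∑[ P ← decompositions (V H) e j (j ∸ i + 1) ] ∏[ Vₖ ← P ] a₁ (H [ Vₖ ]))
proposition3p3 H isH e e∈E i j 1≤i i<j j≤∣V∣ =
  trans (b≡-∑-contributes H isH e e∈E i<j)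
        -- From `i < j` comes `1 ≤ j ∸ i`, hence at least two blocks are met.
        (cong -_ (∑-contributes≡∑-decompositions H isH e e∈E (ℕ.+-monoˡ-≤ 1 (ℕ.m<n⇒0<n∸m i<j))))
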